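{- The IB termination problem is decidable for FIFO machines: given a FIFO machine $M=(Q,\mathit{Ch},\Sigma,\Delta,q_0)$ and a tuple $(L_c)_{c\in\mathit{Ch}}$ of non-empty regular bounded languages $L_c\subseteq\Sigma_c^\ast$, it is decidable whether there is no infinite execution $s_0\xrightarrow{\beta_1}s_1\xrightarrow{\beta_2}s_2\xrightarrow{\beta_3}\cdots$ from the initial configuration $s_0$ with $\beta_i\in A_M$ and $\beta_1\cdots\beta_i\in\mathrm{Pref}(L_!)$ for all $i$.
   Context: A bounded language over non-empty words $(w_1,\ldots,w_n)$ is a language $L\subseteq w_1^\ast\cdots w_n^\ast$. A FIFO machine is $M=(Q,\mathit{Ch},\Sigma,\Delta,q_0)$ with finite control states $Q$, initial state $q_0$, finite channels $\mathit{Ch}$, alphabet $\Sigma=\biguplus_c\Sigma_c$, and $\Delta\subseteq Q\times A_M\times Q$, $A_M=\{c!a,c?a\mid c\in\mathit{Ch},a\in\Sigma_c\}$. Configurations $(q,\mathbf{w})$ with $\mathbf{w}\in\prod_c\Sigma_c^\ast$; initial $(q_0,(\varepsilon)_c)$. A send $c!a$ appends $a$ to channel $c$; a receive $c?a$ removes $a$ from the head of channel $c$ (only possible if $a$ is at the head); other channels unchanged; the control state moves along a transition of $\Delta$. $L_!=\{\sigma\in A_M^\ast\mid\mathrm{proj}_{c!}(\sigma)\in L_c\ \forall c\}$, where $\mathrm{proj}_{c!}$ keeps the messages of send actions on $c$ and erases all other actions. $\mathrm{Pref}(L)$ is the set of prefixes of words in $L$. -}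

module Defs where

open import Data.Bool using (Bool; T)
open import Data.Fin using (Fin; _≟_)
open import Data.List using (List; []; _∷_; _++_; applyUpTo; concat; foldl; mapMaybe; replicate; tabulate)
open import Data.List.Membership.Propositional using () renaming (_∈_ to _∈ₗ_)
open import Data.Maybe using (Maybe; just; nothing)
open import Data.Nat using (ℕ; suc)
open import Data.Product using (∃-syntax; Σ-syntax; _×_; _,_)
open import Level using (0ℓ)
open import Relation.Binary.PropositionalEquality using (_≡_; _≢_; refl)
open import Relation.Nullary using (¬_; yes; no)
open import Relation.Unary using (Pred; _∈_; _⊆_; _≐_)

Language : Set → Set₁
Language A = Pred (List A) 0ℓ

Pref : {A : Set} → Language A → Language A
Pref L u = ∃[ v ] (u ++ v) ∈ L

record DFA (A : Set) : Set where
  field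
    size   : ℕ
    start  : Fin size
    δ      : Fin size → A → Fin size
    accept : Fin size → Bool

  accepted : Language A
  accepted u = T (accept (foldl δ start u))

Regular : {A : Set} → Language A → Set
Regular {A} L = Σ[ D ∈ DFA A ] L ≐ DFA.accepted D

-- The language w₁* ⋯ wₙ*: the words w₁^k₁ ⋯ wₙ^kₙ.
StarProduct : {A : Set} {n : ℕ} → (Fin n → List A) → Language A
StarProduct {n = n} w u =
  Σ[ k ∈ (Fin n → ℕ) ] u ≡ concat (tabulate λ i → concat (replicate (k i) (w i)))

Bounded : {A : Set} → Language A → Set
Bounded {A} L =
  Σ[ n ∈ ℕ ] Σ[ w ∈ (Fin n → List A) ] (∀ i → w i ≢ []) × L ⊆ StarProduct w

-- Letters are indexed by their channel, so the alphabet is a disjoint union by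
-- construction.  `c ⁇ a` is the receive action c?a (a bare `?` is reserved).
data Action {m : ℕ} (Letter : Fin m → Set) : Set where
  _!_ : (c : Fin m) → Letter c → Action Letter
  _⁇_ : (c : Fin m) → Letter c → Action Letter

record FIFOMachine : Set where
  field
    #states   : ℕ
    #channels : ℕ
    #letters  : Fin #channels → ℕ

  Q : Set
  Q = Fin #states

  Ch : Set
  Ch = Fin #channels

  Letter : Ch → Set
  Letter c = Fin (#letters c)

  A : Set
  A = Action Letter

  field
    Δ  : List (Q × A × Q)
    q₀ : Q

module _ (M : FIFOMachine) where
  open FIFOMachine M

  Config : Set
  Config = Q × ((c : Ch) → List (Letter c))

  initial : Config
  initial = q₀ , λ _ → []

  -- Channel contents are functions, so successor contents are described pointwise.
  data Step : Config → A → Config → Set where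
    send : ∀ {q q′ c a w w′} →
           (q , c ! a , q′) ∈ₗ Δ →
           w′ c ≡ w c ++ a ∷ [] →
           (∀ d → d ≢ c → w′ d ≡ w d) →
           Step (q , w) (c ! a) (q′ , w′)
    receive : ∀ {q q′ c a w w′} →
           (q , c ⁇ a , q′) ∈ₗ Δ →
           w c ≡ a ∷ w′ c →
           (∀ d → d ≢ c → w′ d ≡ w d) →
           Step (q , w) (c ⁇ a) (q′ , w′)

  sentOn : (c : Ch) → A → Maybe (Letter c)
  sentOn c (d ! a) with d ≟ c
  ... | yes refl = just a
  ... | no _     = nothing
  sentOn c (d ⁇ a) = nothing

  proj! : (c : Ch) → List A → List (Letter c)
  proj! c = mapMaybe (sentOn c)

  L! : ((c : Ch) → Language (Letter c)) → Language A
  L! L σ = ∀ c → proj! c σ ∈ L c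

  -- `β i` is the action leading from `s i` to `s (suc i)`, so `applyUpTo β i` is
  -- the word formed by the first i actions.
  record InfiniteExecution (L : (c : Ch) → Language (Letter c)) : Set where
    field
      s        : ℕ → Config
      β        : ℕ → A
      starts   : s 0 ≡ initial
      steps    : ∀ i → Step (s i) (β i) (s (suc i))
      prefixes : ∀ i → applyUpTo β i ∈ Pref (L! L)

  IBTerminates : ((c : Ch) → Language (Letter c)) → Set
  IBTerminates L = ¬ InfiniteExecution L

module Submission where

-- A letter of channel c is replaced by its place in the words w₁, …, wₙ that bound
-- L c, together with the DFA state reached by sending it.  Places are visited block
-- by block, without choice inside a block.  Suppose that a run returns to the same
-- control state and, on every channel, to the same last sent and last received
-- places, with no shorter content and no fewer letters in the block being received.
-- Then the segment in between can be repeated forever: a channel that sends in a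
-- later block than it receives from only loses letters of the latter, so it received
-- nothing, and the content of a channel that sends and receives in the same block is
-- determined by its length.  By Ramsey's theorem every branch of the finitely
-- branching tree of runs ends or meets such a repetition, so a search of the tree
-- finds an infinite execution or a bound on the length of all runs.

open import Defs
open import Data.Bool using (T)
import Data.Bool.Properties as Bool
open import Data.Empty using (⊥)
open import Data.Fin as Fin using (Fin; zero; suc; toℕ; fromℕ<)
import Data.Fin.Properties as Fin
open import Data.List using (List; []; _∷_; _++_; allFin; applyUpTo; concat; concatMap; drop; filter; foldl; length; lookup; map; replicate; tabulate; take)
open import Data.List.Membership.Propositional using () renaming (_∈_ to _∈ₗ_)
open import Data.List.Membership.Propositional.Properties using (∈-allFin; ∈-map⁺; ∈-concatMap⁺)
open import Data.List.Properties using (length-++; length-take; length-drop; take++drop≡id; drop-all; ++-identityʳ; ++-assoc; ∷-injective; filter-++; filter-accept; filter-reject; foldl-++; map-++; map-applyUpTo; mapMaybe-++)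
open import Data.List.Relation.Unary.Any as Any using (here; there; index)
open import Data.List.Relation.Unary.Any.Properties using (lookup-index)
open import Data.Maybe as Maybe using (Maybe; just; nothing)
import Data.Maybe.Properties as Maybe
open import Data.Nat using (ℕ; zero; suc; _+_; _∸_; _⊔_; _⊓_; _≤_; _<_; z≤n; s≤s)
open import Data.Nat.Induction using (<-rec)
open import Data.Nat.Properties as ℕ using (≤-trans; ≤-reflexive; ≤-antisym; <-≤-trans; ≤-<-connex)
open import Data.Product using (Σ; Σ-syntax; ∃; ∃-syntax; _×_; _,_; proj₁; proj₂)
import Data.Product.Properties as Product
open import Data.Sum as Sum using (_⊎_; inj₁; inj₂; [_,_]′)
open import Data.Unit using (⊤; tt)
open import Function using (_∘_; _on_; case_of_; id)
open import Level using (0ℓ)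
open import Relation.Binary using (Rel; DecidableEquality)
open import Relation.Binary.PropositionalEquality using (_≡_; _≢_; refl; sym; trans; cong; cong₂; subst; subst₂; module ≡-Reasoning)
open import Relation.Nullary using (Dec; yes; no; ¬_; contradiction; _×-dec_; _⊎-dec_)
open import Relation.Nullary.Decidable using (map′)
open import Relation.Unary using (Pred; Satisfiable; _∈_)

-- Almost-full relations

-- Every infinite sequence meets i < j with R (xᵢ, xⱼ), phrased inductively
-- (Vytiniotis, Coquand, Wahlstedt) so that it can drive a recursion.
data AlmostFull {X : Set} (R : Rel X 0ℓ) : Set where
  now   : (∀ x y → R x y) → AlmostFull R
  later : (∀ x → AlmostFull (λ y z → R y z ⊎ R x y)) → AlmostFull R

module _ {X : Set} where

  af-mono : {R S : Rel X 0ℓ} → (∀ {x y} → R x y → S x y) → AlmostFull R → AlmostFull S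
  af-mono R⊆S (now r)   = now λ x y → R⊆S (r x y)
  af-mono R⊆S (later f) = later λ x → af-mono (λ { (inj₁ r) → inj₁ (R⊆S r) ; (inj₂ r) → inj₂ (R⊆S r) }) (f x)

  join : {R C D : Set} → R ⊎ C → R ⊎ D → R ⊎ (C × D)
  join (inj₁ r) _        = inj₁ r
  join (inj₂ c) (inj₁ r) = inj₁ r
  join (inj₂ c) (inj₂ d) = inj₂ (c , d)

  regroup : {P Q E F : Set} → (P ⊎ (Q ⊎ E)) ⊎ F → (P ⊎ (Q ⊎ F)) ⊎ E
  regroup (inj₁ (inj₁ p))        = inj₁ (inj₁ p)
  regroup (inj₁ (inj₂ (inj₁ q))) = inj₁ (inj₂ (inj₁ q))
  regroup (inj₁ (inj₂ (inj₂ e))) = inj₂ e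
  regroup (inj₂ f)               = inj₁ (inj₂ (inj₂ f))

  -- `R` collects what earlier points already settle. Unfolding `later` at x moves `R x y` into it,
  -- while the nullary alternatives stay unchanged.
  af-joinNullary : {A B R : Rel X 0ℓ} {C D : Set} → AlmostFull A → AlmostFull B →
    (∀ {x y} → A x y → R x y ⊎ C) → (∀ {x y} → B x y → R x y ⊎ D) →
    AlmostFull (λ x y → R x y ⊎ (C × D))
  af-joinNullary (now a) afB A⊆ B⊆ = af-mono (λ {x} {y} b → join (A⊆ (a x y)) (B⊆ b)) afB
  af-joinNullary {A} {B} {R} {C} {D} (later f) afB A⊆ B⊆ = later λ x →
    af-mono
      (λ { (inj₁ (inj₁ r)) → inj₁ (inj₁ r)
         ; (inj₁ (inj₂ r)) → inj₂ (inj₁ r)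
         ; (inj₂ cd)       → inj₁ (inj₂ cd) })
      (af-joinNullary {R = λ y z → R y z ⊎ R x y} (f x) afB
        (λ { (inj₁ a) → [ inj₁ ∘ inj₁ , inj₂ ]′ (A⊆ a)
           ; (inj₂ a) → [ inj₁ ∘ inj₂ , inj₂ ]′ (A⊆ a) })
        (λ b → [ inj₁ ∘ inj₁ , inj₂ ]′ (B⊆ b)))

  af-joinUnary : {A B R : Rel X 0ℓ} {C D : Pred X 0ℓ} → AlmostFull A → AlmostFull B →
    (∀ {x y} → A x y → R x y ⊎ C x) → (∀ {x y} → B x y → R x y ⊎ D x) →
    AlmostFull (λ x y → R x y ⊎ (C x × D x))
  af-joinUnary (now a) afB A⊆ B⊆ = af-mono (λ {x} {y} b → join (A⊆ (a x y)) (B⊆ b)) afB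
  af-joinUnary afA@(later _) (now b) A⊆ B⊆ = af-mono (λ {x} {y} a → join (A⊆ a) (B⊆ (b x y))) afA
  af-joinUnary {A} {B} {R} {C} {D} (later f) (later g) A⊆ B⊆ = later λ x →
    af-mono
      (λ { (inj₁ (inj₁ r))         → inj₁ (inj₁ r)
         ; (inj₁ (inj₂ (inj₁ r)))  → inj₂ (inj₁ r)
         ; (inj₁ (inj₂ (inj₂ cd))) → inj₁ (inj₂ cd)
         ; (inj₂ cd)               → inj₂ (inj₂ cd) })
      -- Lowering one of the two proofs at a time leaves over `C x` and `D x` at the fixed x, which
      -- the nullary stage combines.
      (af-joinNullary
        {R = λ y z → R y z ⊎ (R x y ⊎ (C y × D y))} {C = C x} {D = D x}
        (af-joinUnary {R = λ y z → R y z ⊎ (R x y ⊎ C x)} {C = C} {D = D} (f x) (later g)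
          (λ { (inj₁ a) → [ inj₁ ∘ inj₁ , inj₂ ]′ (A⊆ a)
             ; (inj₂ a) → inj₁ (inj₂ (A⊆ a)) })
          (λ b → [ inj₁ ∘ inj₁ , inj₂ ]′ (B⊆ b)))
        (af-joinUnary {R = λ y z → R y z ⊎ (R x y ⊎ D x)} {C = C} {D = D} (later f) (g x)
          (λ a → [ inj₁ ∘ inj₁ , inj₂ ]′ (A⊆ a))
          (λ { (inj₁ b) → [ inj₁ ∘ inj₁ , inj₂ ]′ (B⊆ b)
             ; (inj₂ b) → inj₁ (inj₂ (B⊆ b)) }))
        regroup regroup)

  af-joinBinary : {A B R C D : Rel X 0ℓ} → AlmostFull A → AlmostFull B →
    (∀ {x y} → A x y → R x y ⊎ C x y) → (∀ {x y} → B x y → R x y ⊎ D x y) →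
    AlmostFull (λ x y → R x y ⊎ (C x y × D x y))
  af-joinBinary (now a) afB A⊆ B⊆ = af-mono (λ {x} {y} b → join (A⊆ (a x y)) (B⊆ b)) afB
  af-joinBinary afA@(later _) (now b) A⊆ B⊆ = af-mono (λ {x} {y} a → join (A⊆ a) (B⊆ (b x y))) afA
  af-joinBinary {A} {B} {R} {C} {D} (later f) (later g) A⊆ B⊆ = later λ x →
    af-mono
      (λ { (inj₁ (inj₁ r))         → inj₁ (inj₁ r)
         ; (inj₁ (inj₂ (inj₁ r)))  → inj₂ (inj₁ r)
         ; (inj₁ (inj₂ (inj₂ cd))) → inj₁ (inj₂ cd)
         ; (inj₂ cd)               → inj₂ (inj₂ cd) })
      -- Here the leftovers `C x` and `D x` still depend on the next point, so the unary stage
      -- combines them.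
      (af-joinUnary
        {R = λ y z → R y z ⊎ (R x y ⊎ (C y z × D y z))} {C = C x} {D = D x}
        (af-joinBinary {R = λ y z → R y z ⊎ (R x y ⊎ C x y)} {C = C} {D = D} (f x) (later g)
          (λ { (inj₁ a) → [ inj₁ ∘ inj₁ , inj₂ ]′ (A⊆ a)
             ; (inj₂ a) → inj₁ (inj₂ (A⊆ a)) })
          (λ b → [ inj₁ ∘ inj₁ , inj₂ ]′ (B⊆ b)))
        (af-joinBinary {R = λ y z → R y z ⊎ (R x y ⊎ D x y)} {C = C} {D = D} (later f) (g x)
          (λ a → [ inj₁ ∘ inj₁ , inj₂ ]′ (A⊆ a))
          (λ { (inj₁ b) → [ inj₁ ∘ inj₁ , inj₂ ]′ (B⊆ b)
             ; (inj₂ b) → inj₁ (inj₂ (B⊆ b)) }))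
        regroup regroup)

  -- The intuitionistic Ramsey theorem; the nullary and unary versions are the
  -- stages of its induction.
  af-× : {R S : Rel X 0ℓ} → AlmostFull R → AlmostFull S → AlmostFull (λ x y → R x y × S x y)
  af-× {R} {S} afR afS = af-mono (λ { (inj₂ rs) → rs }) (af-joinBinary {R = λ _ _ → ⊥} afR afS inj₂ inj₂)

  af-Π : ∀ {m} {R : Fin m → Rel X 0ℓ} → (∀ i → AlmostFull (R i)) → AlmostFull (λ x y → ∀ i → R i x y)
  af-Π {zero}  af = now λ _ _ ()
  af-Π {suc m} af = af-mono (λ { (r , rs) zero → r ; (r , rs) (suc i) → rs i }) (af-× (af zero) (af-Π (af ∘ suc)))

af-on : {X Y : Set} {R : Rel Y 0ℓ} (f : X → Y) → AlmostFull R → AlmostFull (R on f)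
af-on f (now r)   = now λ x y → r (f x) (f y)
af-on f (later g) = later λ x → af-on f (g (f x))

af-≤ : AlmostFull _≤_
af-≤ = later bounded
  where
  -- After x, a sequence avoids a hit only by dropping below x, and each drop strictly lowers the
  -- bound.
  bounded : ∀ x → AlmostFull (λ y z → y ≤ z ⊎ x ≤ y)
  bounded = <-rec _ λ x rec → later λ y → case ≤-<-connex x y of λ where
    (inj₁ x≤y) → now λ _ _ → inj₂ (inj₂ x≤y)
    (inj₂ y<x) → af-mono (λ { (inj₁ u≤v) → inj₁ (inj₁ u≤v) ; (inj₂ y≤u) → inj₂ (inj₁ y≤u) }) (rec y<x)

-- Finite types and their equality

record Finite (X : Set) : Set where
  field
    elements : List X
    covers   : ∀ x → x ∈ₗ elements
    _≟_      : DecidableEquality X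

finiteFin : ∀ n → Finite (Fin n)
finiteFin n = record { elements = allFin n ; covers = ∈-allFin ; _≟_ = Fin._≟_ }

finiteΣ : {X : Set} {Y : X → Set} → Finite X → (∀ x → Finite (Y x)) → Finite (Σ X Y)
finiteΣ fx fy = record
  { elements = concatMap (λ x → map (x ,_) (elements (fy x))) (elements fx)
  ; covers   = λ { (x , y) → ∈-concatMap⁺ _ (Any.map (λ { refl → ∈-map⁺ (x ,_) (covers (fy x) y) }) (covers fx x)) }
  ; _≟_      = Product.≡-dec (_≟_ fx) (λ {x} → _≟_ (fy x))
  }
  where open Finite

finiteMaybe : {X : Set} → Finite X → Finite (Maybe X)
finiteMaybe fx = record
  { elements = nothing ∷ map just elements
  ; covers   = λ { nothing → here refl ; (just x) → there (∈-map⁺ just (covers x)) }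
  ; _≟_      = Maybe.≡-dec _≟_
  }
  where open Finite fx

-- Equality is the intersection of the order with its reverse, and the reverse becomes `≤` under
-- `n ∸ toℕ i`.
af-≡Fin : ∀ {n} → AlmostFull {Fin n} _≡_
af-≡Fin {n} = af-mono
  (λ { (i≤j , n∸i≤n∸j) →
     Fin.toℕ-injective (ℕ.∸-cancelˡ-≡ (Fin.toℕ≤n _) (Fin.toℕ≤n _) (≤-antisym n∸i≤n∸j (ℕ.∸-monoʳ-≤ n i≤j))) })
  (af-× (af-on toℕ af-≤) (af-on (λ i → n ∸ toℕ i) af-≤))

af-≡ : {X : Set} → Finite X → AlmostFull {X} _≡_
af-≡ fin = af-mono
  (λ eq → trans (lookup-index (covers _)) (trans (cong (lookup elements) eq) (sym (lookup-index (covers _)))))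
  (af-on (index ∘ covers) af-≡Fin)
  where open Finite fin

-- Channels along a block-deterministic automaton

-- `nothing` is the situation before the first letter.
data Walk {Pos : Set} (Next : Maybe Pos → Pos → Set) : Maybe Pos → List Pos → Maybe Pos → Set where
  []  : ∀ {p} → Walk Next p [] p
  _∷_ : ∀ {p q ps e} → Next p q → Walk Next (just q) ps e → Walk Next p (q ∷ ps) e

walk-++ : {Pos : Set} {Next : Maybe Pos → Pos → Set} → ∀ {p ps q qs e} →
  Walk Next p ps q → Walk Next q qs e → Walk Next p (ps ++ qs) e
walk-++ []      v = v
walk-++ (n ∷ w) v = n ∷ walk-++ w v

-- A nondeterministic automaton for P, all of whose states accept, whose blocks
-- are traversed in order and which has no choice as long as it stays in a block.
record Track {Letter : Set} (P : Pred (List Letter) 0ℓ) : Set₁ where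
  field
    Pos           : Set
    finite        : Finite Pos
    letter        : Pos → Letter
    block         : Maybe Pos → ℕ
    Next          : Maybe Pos → Pos → Set
    next?         : ∀ p q → Dec (Next p q)
    block-mono    : ∀ {p q} → Next p q → block p ≤ block (just q)
    deterministic : ∀ {p q r} → Next p q → Next p r → block p ≡ block (just q) → block p ≡ block (just r) → q ≡ r
    sound         : ∀ {ps e} → Walk Next nothing ps e → P (map letter ps)
    complete      : ∀ {u} → P u → ∃[ ps ] ∃[ e ] Walk Next nothing ps e × map letter ps ≡ u

-- An action as seen from one channel; `idle` stands for an action on another channel.
data Local (Pos : Set) : Set where
  idle : Local Pos
  snd  : Pos → Local Pos
  rcv  : Pos → Local Pos

sends : {Pos : Set} → List (Local Pos) → List Pos
sends []           = []
sends (idle  ∷ ls) = sends ls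
sends (snd p ∷ ls) = p ∷ sends ls
sends (rcv _ ∷ ls) = sends ls

#receives : {Pos : Set} → List (Local Pos) → ℕ
#receives []           = 0
#receives (idle  ∷ ls) = #receives ls
#receives (snd _ ∷ ls) = #receives ls
#receives (rcv _ ∷ ls) = suc (#receives ls)

module Channel {Letter : Set} {P : Pred (List Letter) 0ℓ} (T : Track P) where
  open Track T

  -- `received` and `sent` are the last positions received and sent, so in a reachable state the
  -- content is a walk from the one to the other.
  record State : Set where
    constructor ⟨_,_,_⟩
    field
      received : Maybe Pos
      content  : List Pos
      sent     : Maybe Pos

  open State public

  empty : State
  empty = ⟨ nothing , [] , nothing ⟩

  data LStep : State → Local Pos → State → Set where
    idle : ∀ {x} → LStep x idle x
    snd  : ∀ {r ps s p} → Next s p → LStep ⟨ r , ps , s ⟩ (snd p) ⟨ r , ps ++ p ∷ [] , just p ⟩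
    rcv  : ∀ {r ps s p} → LStep ⟨ r , p ∷ ps , s ⟩ (rcv p) ⟨ just p , ps , s ⟩

  data LPath : State → List (Local Pos) → State → Set where
    []  : ∀ {x} → LPath x [] x
    _∷_ : ∀ {x l y ls z} → LStep x l y → LPath y ls z → LPath x (l ∷ ls) z

  lstep? : ∀ x l → Dec (∃[ y ] LStep x l y)
  lstep? x                      idle    = yes (x , idle)
  lstep? ⟨ r , ps , s ⟩         (snd p) with next? s p
  ... | yes n = yes (_ , snd n)
  ... | no ¬n = no λ { (_ , snd n) → ¬n n }
  lstep? ⟨ r , [] , s ⟩         (rcv p) = no λ { (_ , ()) }
  lstep? ⟨ r , q ∷ ps , s ⟩     (rcv p) with Finite._≟_ finite q p
  ... | yes refl = yes (_ , rcv)
  ... | no q≢p   = no λ { (_ , rcv) → q≢p refl }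

  lstep-functional : ∀ {x l y z} → LStep x l y → LStep x l z → y ≡ z
  lstep-functional idle    idle    = refl
  lstep-functional (snd _) (snd _) = refl
  lstep-functional rcv     rcv     = refl

  Valid : State → Set
  Valid x = Walk Next (received x) (content x) (sent x)

  valid-step : ∀ {x l y} → LStep x l y → Valid x → Valid y
  valid-step idle    w       = w
  valid-step (snd n) w       = walk-++ w (n ∷ [])
  valid-step rcv     (_ ∷ w) = w

  valid-path : ∀ {x ls y} → LPath x ls y → Valid x → Valid y
  valid-path []       v = v
  valid-path (s ∷ ss) v = valid-path ss (valid-step s v)

  walk-mono : ∀ {p ps e} → Walk Next p ps e → block p ≤ block e
  walk-mono []      = ℕ.≤-refl
  walk-mono (n ∷ w) = ≤-trans (block-mono n) (walk-mono w)

  stays : ∀ {p q qs e} → Next p q → Walk Next (just q) qs e → block e ≤ block p → block p ≡ block (just q)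
  stays n w e≤p = ≤-antisym (block-mono n) (≤-trans (walk-mono w) e≤p)

  sent-mono : ∀ {x ls y} → LPath x ls y → block (sent x) ≤ block (sent y)
  sent-mono []           = ℕ.≤-refl
  sent-mono (idle  ∷ ss) = sent-mono ss
  sent-mono (snd n ∷ ss) = ≤-trans (block-mono n) (sent-mono ss)
  sent-mono (rcv   ∷ ss) = sent-mono ss

  received-mono : ∀ {x ls y} → LPath x ls y → Valid x → block (received x) ≤ block (received y)
  received-mono []           v       = ℕ.≤-refl
  received-mono (idle  ∷ ss) v       = received-mono ss v
  received-mono (snd n ∷ ss) v       = received-mono ss (walk-++ v (n ∷ []))
  received-mono (rcv   ∷ ss) (n ∷ v) = ≤-trans (block-mono n) (received-mono ss v)

  path-sends : ∀ {x ls y} → LPath x ls y → Walk Next (sent x) (sends ls) (sent y)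
  path-sends []           = []
  path-sends (idle  ∷ ss) = path-sends ss
  path-sends (snd n ∷ ss) = n ∷ path-sends ss
  path-sends (rcv   ∷ ss) = path-sends ss

  #block : ℕ → List Pos → ℕ
  #block j = length ∘ filter (λ p → block (just p) ℕ.≟ j)

  #block-∷ʳ : ∀ {j p} ps → block (just p) ≢ j → #block j (ps ++ p ∷ []) ≡ #block j ps
  #block-∷ʳ {j} {p} ps ≢j = cong length
    (trans (filter-++ (λ q → block (just q) ℕ.≟ j) ps (p ∷ []))
      (trans (cong (filter (λ q → block (just q) ℕ.≟ j) ps ++_) (filter-reject (λ q → block (just q) ℕ.≟ j) ≢j)) (++-identityʳ _)))

  -- All sends lie in blocks beyond j and add nothing to the count. The last received position stays
  -- in block j, so each receive removes one letter of that block.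
  drain : ∀ {x ls y j} → LPath x ls y → Valid x →
    j ≤ block (received x) → block (received y) ≤ j → j < block (sent x) →
    #receives ls + #block j (content y) ≡ #block j (content x)
  drain [] v j≤r r≤j j<s = refl
  drain (idle ∷ ss) v j≤r r≤j j<s = drain ss v j≤r r≤j j<s
  drain (snd {ps = ps} n ∷ ss) v j≤r r≤j j<s =
    trans (drain ss (walk-++ v (n ∷ [])) j≤r r≤j (<-≤-trans j<s (block-mono n)))
      (#block-∷ʳ ps (ℕ.>⇒≢ (<-≤-trans j<s (block-mono n))))
  drain {j = j} (rcv {ps = ps} {p = p} ∷ ss) (n ∷ v) j≤r r≤j j<s =
    trans (cong suc (drain ss v j≤p r≤j j<s))
      (sym (cong length (filter-accept (λ q → block (just q) ℕ.≟ j) (≤-antisym (≤-trans (received-mono ss v) r≤j) j≤p))))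
    where
    j≤p : j ≤ block (just p)
    j≤p = ≤-trans j≤r (block-mono n)

  infix 4 _≼_

  record _≼_ (x y : State) : Set where
    constructor ≼-intro
    field
      received-≡ : received x ≡ received y
      sent-≡     : sent x ≡ sent y
      length-≤   : length (content x) ≤ length (content y)

  open _≼_

  -- Along a loop that does receive, the content stays in a single block, so that
  -- what the channel delivers is determined by what it delivered before.
  simulate : ∀ {x ls y x′} → LPath x ls y → Valid x → Valid x′ → x ≼ x′ →
    #receives ls ≡ 0 ⊎ block (sent y) ≤ block (received x) →
    ∃[ y′ ] LPath x′ ls y′ × y ≼ y′
  simulate [] v v′ x≼x′ mode = _ , [] , x≼x′
  simulate (idle ∷ ss) v v′ x≼x′ mode with simulate ss v v′ x≼x′ mode
  ... | y′ , ss′ , y≼y′ = y′ , idle ∷ ss′ , y≼y′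
  simulate {x′ = ⟨ _ , ps′ , _ ⟩} (snd {ps = ps} n ∷ ss) v v′ (≼-intro refl refl len) mode
    with simulate ss (walk-++ v (n ∷ [])) (walk-++ v′ (n ∷ []))
           (≼-intro refl refl
             (ℕ.≤-trans (≤-reflexive (length-++ ps)) (ℕ.≤-trans (ℕ.+-monoˡ-≤ 1 len) (≤-reflexive (sym (length-++ ps′))))))
           mode
  ... | y′ , ss′ , y≼y′ = y′ , snd n ∷ ss′ , y≼y′
  simulate {x′ = ⟨ _ , [] , _ ⟩} (rcv ∷ ss) v v′ (≼-intro refl refl ()) mode
  simulate {y = y} {x′ = ⟨ r , p′ ∷ ps′ , s ⟩} (rcv {p = p} ∷ ss) (n ∷ v) (n′ ∷ v′) (≼-intro refl refl (s≤s len)) (inj₂ s≤r)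
    -- Both contents lead from the same position to the same last sent one, whose block is not
    -- beyond that of the former. Hence neither head leaves the block, and the two heads coincide.
    with refl ← deterministic n n′ (stays n v (≤-trans (sent-mono ss) s≤r)) (stays n′ v′ (≤-trans (sent-mono ss) s≤r))
    with simulate ss v v′ (≼-intro refl refl len) (inj₂ (≤-trans s≤r (block-mono n)))
  ... | y′ , ss′ , y≼y′ = y′ , rcv ∷ ss′ , y≼y′

  record Loop (x : State) (ls : List (Local Pos)) : Set where
    field
      {end}   : State
      path    : LPath x ls end
      valid   : Valid x
      growing : x ≼ end
      mode    : #receives ls ≡ 0 ⊎ block (sent end) ≤ block (received x)

  -- Simulating the segment from its own end gives a second copy. `mode` depends only on the last
  -- positions, which have not changed.
  repeat : ∀ {x ls} (l : Loop x ls) → Loop (Loop.end l) ls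
  repeat l with simulate path valid (valid-path path valid) growing mode
    where open Loop l
  ... | y , path′ , growing′ = record
    { path    = path′
    ; valid   = valid-path path valid
    ; growing = growing′
    ; mode    = Sum.map₂ (subst₂ (λ s r → block s ≤ block r) (sent-≡ growing′) (received-≡ growing)) mode
    }
    where
    open Loop l

  infix 4 _⊑_

  -- The second component is the quantity that, by `drain`, falls with each receive once sending has
  -- moved to a later block.
  _⊑_ : Rel State 0ℓ
  x ⊑ y = x ≼ y × #block (block (received x)) (content x) ≤ #block (block (received y)) (content y)

  af-⊑ : AlmostFull _⊑_
  af-⊑ = af-mono (λ { ((r , s) , l , b) → ≼-intro r s l , b })
    (af-× (af-× (af-on received (af-≡ (finiteMaybe finite))) (af-on sent (af-≡ (finiteMaybe finite))))
          (af-× (af-on (length ∘ content) af-≤) (af-on (λ x → #block (block (received x)) (content x)) af-≤)))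

  loop : ∀ {x ls y} → LPath x ls y → Valid x → x ⊑ y → Loop x ls
  loop {x} {ls} {y} path v (x≼y@(≼-intro refl refl _) , block≤) =
    record { path = path ; valid = v ; growing = x≼y ; mode = mode }
    where
    mode : #receives ls ≡ 0 ⊎ block (sent y) ≤ block (received x)
    mode with ≤-<-connex (block (sent y)) (block (received x))
    ... | inj₁ s≤r = inj₂ s≤r
    -- By `drain`, the receives and the final count add up to the initial count, which is at most
    -- the final one.
    ... | inj₂ r<s = inj₁ (ℕ.n≤0⇒n≡0 (ℕ.+-cancelʳ-≤ (#block (block (received x)) (content y)) _ 0
      (≤-trans (≤-reflexive (drain path v ℕ.≤-refl ℕ.≤-refl r<s)) block≤)))

-- A track for the prefixes of a regular bounded language

module Coaccessibility {k : ℕ} (D : DFA (Fin k)) where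
  open DFA D

  Coaccessible : Fin size → Set
  Coaccessible d = ∃[ v ] T (accept (foldl δ d v))

  -- Pumping: among the `size + 1` shortest prefixes of v two reach the same state, and the factor
  -- between them can be cut out.
  shorten : ∀ d v → size ≤ length v → ∃[ v′ ] length v′ < length v × foldl δ d v′ ≡ foldl δ d v
  shorten d v size≤v with Fin.pigeonhole (ℕ.n<1+n size) (λ i → foldl δ d (take (toℕ i) v))
  ... | i , j , i<j , eq = take (toℕ i) v ++ drop (toℕ j) v , shorter , same
    where
    shorter : length (take (toℕ i) v ++ drop (toℕ j) v) < length v
    shorter = begin-strict
      length (take (toℕ i) v ++ drop (toℕ j) v)         ≡⟨ length-++ (take (toℕ i) v) ⟩
      length (take (toℕ i) v) + length (drop (toℕ j) v) ≡⟨ cong₂ _+_ (length-take (toℕ i) v) (length-drop (toℕ j) v) ⟩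
      toℕ i ⊓ length v + (length v ∸ toℕ j)             ≤⟨ ℕ.+-monoˡ-≤ _ (ℕ.m⊓n≤m (toℕ i) (length v)) ⟩
      toℕ i + (length v ∸ toℕ j)                        <⟨ ℕ.+-monoˡ-< _ i<j ⟩
      toℕ j + (length v ∸ toℕ j)                        ≡⟨ ℕ.m+[n∸m]≡n (≤-trans (Fin.toℕ≤pred[n] j) size≤v) ⟩
      length v                                          ∎
      where open ℕ.≤-Reasoning

    same : foldl δ d (take (toℕ i) v ++ drop (toℕ j) v) ≡ foldl δ d v
    same = begin
      foldl δ d (take (toℕ i) v ++ drop (toℕ j) v)           ≡⟨ foldl-++ δ d (take (toℕ i) v) _ ⟩
      foldl δ (foldl δ d (take (toℕ i) v)) (drop (toℕ j) v)  ≡⟨ cong (λ e → foldl δ e (drop (toℕ j) v)) eq ⟩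
      foldl δ (foldl δ d (take (toℕ j) v)) (drop (toℕ j) v)  ≡⟨ foldl-++ δ d (take (toℕ j) v) _ ⟨
      foldl δ d (take (toℕ j) v ++ drop (toℕ j) v)           ≡⟨ cong (foldl δ d) (take++drop≡id (toℕ j) v) ⟩
      foldl δ d v                                            ∎
      where open ≡-Reasoning

  Within : ℕ → Fin size → Set
  Within m d = ∃[ v ] length v ≤ m × T (accept (foldl δ d v))

  within? : ∀ m d → Dec (Within m d)
  within? zero    d = map′ (λ t → [] , z≤n , t) (λ { ([] , _ , t) → t }) (Bool.T? (accept d))
  within? (suc m) d = map′
    (λ { (inj₁ t) → [] , z≤n , t ; (inj₂ (a , v , v≤m , t)) → a ∷ v , s≤s v≤m , t })
    (λ { ([] , _ , t) → inj₁ t ; (a ∷ v , s≤s v≤m , t) → inj₂ (a , v , v≤m , t) })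
    (Bool.T? (accept d) ⊎-dec Fin.any? (λ a → within? m (δ d a)))

  -- Repeated shortening brings any witness down to length at most `size`, which leaves finitely
  -- many words to try.
  coaccessible? : ∀ d → Dec (Coaccessible d)
  coaccessible? d = map′ (λ { (v , _ , t) → v , t }) (λ { (v , t) → short (length v) v refl t }) (within? size d)
    where
    short : ∀ m v → length v ≡ m → T (accept (foldl δ d v)) → Within size d
    short = <-rec _ λ where
      m rec v refl t → case ≤-<-connex (length v) size of λ where
        (inj₁ v≤size) → v , v≤size , t
        (inj₂ size<v) → case shorten d v (ℕ.<⇒≤ size<v) of λ where
          (v′ , v′<v , eq) → rec v′<v v′ refl (subst (T ∘ accept) (sym eq) t)

drop-lookup : {X : Set} (xs : List X) (i : Fin (length xs)) → drop (toℕ i) xs ≡ lookup xs i ∷ drop (suc (toℕ i)) xs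
drop-lookup (x ∷ xs) zero    = refl
drop-lookup (x ∷ xs) (suc i) = drop-lookup xs i

-- Places in the bounding words

module Places {k n : ℕ} (w : Fin n → List (Fin k)) (w≢[] : ∀ i → w i ≢ []) where

  Place : Set
  Place = Σ[ i ∈ Fin n ] Fin (length (w i))

  infix 4 _↝_

  -- From the last letter of a word the walk may restart the same word, which raises its exponent,
  -- or begin any later one, which allows exponents zero in between.
  _↝_ : Maybe Place → Place → Set
  nothing      ↝ (j , o′) = toℕ o′ ≡ 0
  just (i , o) ↝ (j , o′) =
    (i ≡ j × toℕ o′ ≡ suc (toℕ o)) ⊎ (suc (toℕ o) ≡ length (w i) × i Fin.≤ j × toℕ o′ ≡ 0)

  _↝?_ : ∀ p q → Dec (p ↝ q)
  nothing      ↝? (j , o′) = toℕ o′ ℕ.≟ 0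
  just (i , o) ↝? (j , o′) =
    (i Fin.≟ j ×-dec toℕ o′ ℕ.≟ suc (toℕ o)) ⊎-dec (suc (toℕ o) ℕ.≟ length (w i) ×-dec i Fin.≤? j ×-dec toℕ o′ ℕ.≟ 0)

  -- Block 0 is reserved for the start, so the free choice of the first place counts as a change of
  -- block.
  blockIndex : Maybe Place → ℕ
  blockIndex nothing        = 0
  blockIndex (just (i , _)) = suc (toℕ i)

  ↝-mono : ∀ p {q} → p ↝ q → blockIndex p ≤ blockIndex (just q)
  ↝-mono nothing  _                       = z≤n
  ↝-mono (just _) (inj₁ (refl , _))       = ℕ.≤-refl
  ↝-mono (just _) (inj₂ (_ , i≤j , _))    = s≤s i≤j

  -- Within one word an offset either has a successor or is the last and wraps around to 0, never
  -- both.
  ↝-deterministic : ∀ p {q r} → p ↝ q → p ↝ r → blockIndex p ≡ blockIndex (just q) → blockIndex p ≡ blockIndex (just r) → q ≡ r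
  ↝-deterministic (just (i , o)) {j , o′} {j′ , o″} p↝q p↝r i≡j i≡j′
    with refl ← Fin.toℕ-injective (ℕ.suc-injective i≡j)
       | refl ← Fin.toℕ-injective (ℕ.suc-injective i≡j′) = cong (i ,_) (Fin.toℕ-injective (same p↝q p↝r))
    where
    beyond : ∀ {o′ : Fin (length (w i))} → toℕ o′ ≡ suc (toℕ o) → suc (toℕ o) ≢ length (w i)
    beyond {o′} o′≡ o≡ = ℕ.<⇒≢ (Fin.toℕ<n o′) (trans o′≡ o≡)

    same : ∀ {o′ o″} → just (i , o) ↝ (i , o′) → just (i , o) ↝ (i , o″) → toℕ o′ ≡ toℕ o″
    same (inj₁ (_ , e))     (inj₁ (_ , e′))     = trans e (sym e′)
    same (inj₁ (_ , e))     (inj₂ (l , _))      = contradiction l (beyond e)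
    same (inj₂ (l , _))     (inj₁ (_ , e′))     = contradiction l (beyond e′)
    same (inj₂ (_ , _ , e)) (inj₂ (_ , _ , e′)) = trans e (sym e′)

  letterAt : Place → Fin k
  letterAt (i , o) = lookup (w i) o

  -- `Q` is a postcondition on the final place, through which readings are chained.
  Reads : Maybe Place → List (Fin k) → (Maybe Place → Set) → Set
  Reads p u Q = ∃[ ps ] ∃[ e ] Walk _↝_ p ps e × map letterAt ps ≡ u × Q e

  reads-++ : ∀ {p u v Q R} → Reads p u Q → (∀ {e} → Q e → Reads e v R) → Reads p (u ++ v) R
  reads-++ (ps , e , wk , refl , q) f with f q
  ... | ps′ , e′ , wk′ , refl , r = ps ++ ps′ , e′ , walk-++ wk wk′ , map-++ letterAt ps ps′ , r

  Ready : Fin n → Maybe Place → Set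
  Ready i p = ∀ {j} → i Fin.≤ j → (o : Fin (length (w j))) → toℕ o ≡ 0 → p ↝ (j , o)

  next-offset : ∀ {m l} (o : Fin l) → suc (toℕ o) + suc m ≡ l → ∃[ o′ ] toℕ {l} o′ ≡ suc (toℕ o)
  next-offset {m} o more = fromℕ< o<l , Fin.toℕ-fromℕ< o<l
    where
    o<l = subst (suc (suc (toℕ o)) ≤_) (trans (sym (ℕ.+-suc _ m)) more) (ℕ.m≤m+n _ m)

  -- Induction on the number m of letters after `o`. At m = 0 the word is finished, and every word
  -- from index i on may begin.
  reads-rest : ∀ m i (o : Fin (length (w i))) → suc (toℕ o) + m ≡ length (w i) →
    Reads (just (i , o)) (drop (suc (toℕ o)) (w i)) (Ready i)
  reads-rest zero i o last = [] , _ , [] , sym (drop-all _ (w i) (≤-reflexive (sym end))) , λ i≤j _ z → inj₂ (end , i≤j , z)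
    where
    end : suc (toℕ o) ≡ length (w i)
    end = trans (sym (ℕ.+-identityʳ _)) last
  reads-rest (suc m) i o more with next-offset o more
  ... | o′ , o′≡
    with reads-rest m i o′ (trans (cong (λ x → suc x + m) o′≡) (trans (sym (ℕ.+-suc _ m)) more))
  ... | ps , e , wk , eq , r =
    _ , e , inj₁ (refl , o′≡) ∷ wk ,
    trans (cong (_ ∷_) eq) (trans (sym (drop-lookup (w i) o′)) (cong (λ x → drop x (w i)) o′≡)) , r

  first-offset : ∀ {X : Set} {xs : List X} → xs ≢ [] →
    Σ[ o ∈ Fin (length xs) ] toℕ o ≡ 0 × ∃[ m ] suc (toℕ o) + m ≡ length xs
  first-offset {xs = []}     ≢[] = contradiction refl ≢[]
  first-offset {xs = _ ∷ xs} _   = zero , refl , length xs , refl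

  reads-word : ∀ {p} i → Ready i p → Reads p (w i) (Ready i)
  reads-word i ready with first-offset (w≢[] i)
  ... | o , o≡0 , m , len with reads-rest m i o len
  ... | ps , e , wk , eq , r =
    _ , e , ready Fin.≤-refl o o≡0 ∷ wk ,
    trans (cong (_ ∷_) eq) (trans (sym (drop-lookup (w i) o)) (cong (λ x → drop x (w i)) o≡0)) , r

  reads-power : ∀ {p} i m → Ready i p → Reads p (concat (replicate m (w i))) (Ready i)
  reads-power i zero    ready = [] , _ , [] , refl , ready
  reads-power i (suc m) ready = reads-++ (reads-word i ready) (reads-power i m)

  -- The monotone reindexing f lets the induction drop the first word: being ready for `f zero`
  -- implies being ready for all later words.
  reads-product : ∀ {p} m (f : Fin m → Fin n) (c : Fin m → ℕ) → (∀ {a b} → a Fin.≤ b → f a Fin.≤ f b) →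
    (∀ a → Ready (f a) p) →
    Reads p (concat (tabulate λ a → concat (replicate (c a) (w (f a))))) (λ _ → ⊤)
  reads-product zero    f c mono ready = [] , _ , [] , refl , tt
  reads-product (suc m) f c mono ready =
    reads-++ (reads-power (f zero) (c zero) (ready zero)) λ ready′ →
      reads-product m (f ∘ suc) (c ∘ suc) (mono ∘ s≤s)
        (λ a f≤j → ready′ (Fin.≤-trans (mono {zero} {suc a} z≤n) f≤j))

  reads-starProduct : ∀ {u} → u ∈ StarProduct w → Reads nothing u (λ _ → ⊤)
  reads-starProduct (c , refl) = reads-product n id c id (λ _ _ _ o≡0 → o≡0)

module _ {k : ℕ} {L : Language (Fin k)} where

  -- A place is paired with the DFA state reached. That state follows from the previous one and the
  -- letter, so determinism within a block survives; its co-accessibility gives soundness.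
  boundedTrack : Satisfiable L → Regular L → Bounded L → Track (Pref L)
  boundedTrack (u₀ , u₀∈L) (D , L⊆D , D⊆L) (n , w , w≢[] , L⊆w) = record
    { Pos           = Pos
    ; finite        = finiteΣ (finiteΣ (finiteFin n) (λ i → finiteFin (length (w i)))) (λ _ → finiteFin size)
    ; letter        = letter
    ; block         = blockIndex ∘ place
    ; Next          = Next
    ; next?         = λ { p (q , d) → (place p ↝? q) ×-dec (d Fin.≟ δ (state p) (letterAt q) ×-dec coaccessible? d) }
    ; block-mono    = λ { {p} (p↝q , _) → ↝-mono (place p) p↝q }
    ; deterministic = λ {p} → deterministic {p}
    -- A word of L makes the start state co-accessible, which covers the empty walk.
    ; sound         = λ { {ps} wk → case walk-state (u₀ , L⊆D u₀∈L) wk of λ where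
        (eq , v , t) → v , D⊆L (subst (T ∘ accept) (trans (cong (λ d → foldl δ d v) eq) (sym (foldl-++ δ start (map letter ps) v))) t) }
    ; complete      = λ { {u} (v , uv∈L) → case reads-starProduct (L⊆w uv∈L) of λ where
        (ps , e , wk , eq , _) → lift u v wk eq (L⊆D uv∈L) }
    }
    where
    open DFA D
    open Coaccessibility D
    open Places w w≢[]

    Pos : Set
    Pos = Place × Fin size

    letter : Pos → Fin k
    letter (p , _) = letterAt p

    place : Maybe Pos → Maybe Place
    place = Maybe.map proj₁

    state : Maybe Pos → Fin size
    state nothing        = start
    state (just (_ , d)) = d

    Next : Maybe Pos → Pos → Set
    Next p (q , d) = place p ↝ q × d ≡ δ (state p) (letterAt q) × Coaccessible d

    deterministic : ∀ {p q r} → Next p q → Next p r →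
      blockIndex (place p) ≡ blockIndex (place (just q)) → blockIndex (place p) ≡ blockIndex (place (just r)) → q ≡ r
    deterministic {p} (p↝q , refl , _) (p↝r , refl , _) i≡j i≡j′ =
      cong (λ q → q , δ (state p) (letterAt q)) (↝-deterministic (place p) p↝q p↝r i≡j i≡j′)

    walk-state : ∀ {p ps e} → Coaccessible (state p) → Walk Next p ps e →
      state e ≡ foldl δ (state p) (map letter ps) × Coaccessible (state e)
    walk-state c []                   = refl , c
    walk-state c ((_ , refl , c′) ∷ wk) = walk-state c′ wk

    -- Only the part spelling u is kept; what remains of `u ++ v` after each letter witnesses that
    -- the state reached is co-accessible.
    lift : ∀ {p ps e} u v → Walk _↝_ (place p) ps e → map letterAt ps ≡ u ++ v →
      T (accept (foldl δ (state p) (u ++ v))) → ∃[ qs ] ∃[ f ] Walk Next p qs f × map letter qs ≡ u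
    lift []      v wk eq t = [] , _ , [] , refl
    lift {p} (a ∷ u) v (_∷_ {q = q} n wk) eq t
      with refl , eq′ ← ∷-injective eq
      with lift {p = just (q , δ (state p) (letterAt q))} u v wk eq′ t
    ... | qs , f , wk′ , refl = (q , _) ∷ qs , f , (n , refl , u ++ v , t) ∷ wk′ , refl

-- Runs of a FIFO machine with tracks

module _ {X I : Set} {P : X → ℕ → Set} (fin : Finite X) (mono : ∀ {x m n} → m ≤ n → P x m → P x n)
         (f : ∀ x → I ⊎ ∃ (P x)) where
  open Finite fin

  -- A single outcome in I settles the question; otherwise the maximum of the bounds serves for all
  -- elements.
  uniformBound : I ⊎ ∃[ N ] ∀ x → P x N
  uniformBound = Sum.map₂ (λ { (N , p) → N , λ x → p (covers x) }) (search elements)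
    where
    search : ∀ xs → I ⊎ ∃[ N ] ∀ {x} → x ∈ₗ xs → P x N
    search []       = inj₂ (0 , λ ())
    search (x ∷ xs) with f x | search xs
    ... | inj₁ i       | _            = inj₁ i
    ... | inj₂ _       | inj₁ i       = inj₁ i
    ... | inj₂ (m , p) | inj₂ (n , q) = inj₂ (m ⊔ n , λ where
      (here refl) → mono (ℕ.m≤m⊔n m n) p
      (there x∈)  → mono (ℕ.m≤n⊔m m n) (q x∈))

action-≡-dec : ∀ {m} {Letter : Fin m → Set} → (∀ c → DecidableEquality (Letter c)) → DecidableEquality (Action Letter)
action-≡-dec _≟_ (c ! a) (d ! b) with c Fin.≟ d
... | no c≢d   = no λ { refl → c≢d refl }
... | yes refl with _≟_ c a b
...   | yes refl = yes refl
...   | no a≢b   = no λ { refl → a≢b refl }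
action-≡-dec _≟_ (c ⁇ a) (d ⁇ b) with c Fin.≟ d
... | no c≢d   = no λ { refl → c≢d refl }
... | yes refl with _≟_ c a b
...   | yes refl = yes refl
...   | no a≢b   = no λ { refl → a≢b refl }
action-≡-dec _≟_ (_ ! _) (_ ⁇ _) = no λ ()
action-≡-dec _≟_ (_ ⁇ _) (_ ! _) = no λ ()

-- Prefixes of `L!`, channel by channel

module _ (M : FIFOMachine) where
  open FIFOMachine M

  transition? : ∀ (t : Q × A × Q) → Dec (t ∈ₗ Δ)
  transition? t = Any.any? (Product.≡-dec Fin._≟_ (Product.≡-dec (action-≡-dec λ _ → Fin._≟_) Fin._≟_) t) Δ

  sentOn-self : ∀ c a → sentOn M c (c ! a) ≡ just a
  sentOn-self c a with c Fin.≟ c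
  ... | yes refl = refl
  ... | no c≢c   = contradiction refl c≢c

  sentOn-other : ∀ {c d} a → d ≢ c → sentOn M c (d ! a) ≡ nothing
  sentOn-other {c} {d} a d≢c with d Fin.≟ c
  ... | yes d≡c = contradiction d≡c d≢c
  ... | no _    = refl

  proj!-self : ∀ c u → proj! M c (map (c !_) u) ≡ u
  proj!-self c []      = refl
  proj!-self c (a ∷ u) rewrite sentOn-self c a = cong (a ∷_) (proj!-self c u)

  proj!-other : ∀ {c d} u → d ≢ c → proj! M c (map (d !_) u) ≡ []
  proj!-other []      d≢c = refl
  proj!-other (a ∷ u) d≢c rewrite sentOn-other a d≢c = proj!-other u d≢c

  module _ (L : (c : Ch) → Language (Letter c)) where

    pref-proj! : ∀ σ → σ ∈ Pref (L! M L) → ∀ c → proj! M c σ ∈ Pref (L c)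
    pref-proj! σ (v , σv∈L) c = proj! M c v , subst (L c) (mapMaybe-++ (sentOn M c) σ v) (σv∈L c)

    -- The missing sends are appended one channel after another; those on one channel leave the
    -- other projections unchanged.
    proj!-pref : ∀ σ → (∀ c → proj! M c σ ∈ Pref (L c)) → σ ∈ Pref (L! M L)
    proj!-pref σ p = complete (allFin _) σ p (λ c → inj₁ (∈-allFin c))
      where
      -- `cs` lists the channels whose projections may still be incomplete.
      complete : ∀ cs σ → (∀ c → proj! M c σ ∈ Pref (L c)) → (∀ c → c ∈ₗ cs ⊎ proj! M c σ ∈ L c) →
        σ ∈ Pref (L! M L)
      complete [] σ p done =
        [] , λ c → subst (λ τ → proj! M c τ ∈ L c) (sym (++-identityʳ σ)) ([ (λ ()) , id ]′ (done c))
      complete (d ∷ cs) σ p done with p d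
      ... | v , σv∈L = case complete cs (σ ++ map (d !_) v) p′ done′ of λ { (u , σvu∈L) →
              map (d !_) v ++ u , subst (_∈ L! M L) (++-assoc σ _ u) σvu∈L }
        where
        self : proj! M d (σ ++ map (d !_) v) ∈ L d
        self = subst (L d) (sym (trans (mapMaybe-++ (sentOn M d) σ _) (cong (proj! M d σ ++_) (proj!-self d v)))) σv∈L

        other : ∀ {c} → d ≢ c → proj! M c (σ ++ map (d !_) v) ≡ proj! M c σ
        other {c} d≢c = trans (mapMaybe-++ (sentOn M c) σ _)
          (trans (cong (proj! M c σ ++_) (proj!-other v d≢c)) (++-identityʳ _))

        p′ : ∀ c → proj! M c (σ ++ map (d !_) v) ∈ Pref (L c)
        p′ c with d Fin.≟ c
        ... | yes refl = [] , subst (L d) (sym (++-identityʳ _)) self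
        ... | no d≢c   = subst (Pref (L c)) (sym (other d≢c)) (p c)

        done′ : ∀ c → c ∈ₗ cs ⊎ proj! M c (σ ++ map (d !_) v) ∈ L c
        done′ c with d Fin.≟ c | done c
        ... | yes refl | _                  = inj₂ self
        ... | no d≢c   | inj₁ (here c≡d)    = contradiction (sym c≡d) d≢c
        ... | no d≢c   | inj₁ (there c∈)    = inj₁ c∈
        ... | no d≢c   | inj₂ σ∈L           = inj₂ (subst (L c) (sym (other d≢c)) σ∈L)

-- Annotated runs and their repetition

module Runs (M : FIFOMachine) (L : (c : FIFOMachine.Ch M) → Language (FIFOMachine.Letter M c))
            (T : ∀ c → Track (Pref (L c))) where
  open FIFOMachine M

  Pos : Ch → Set
  Pos c = Track.Pos (T c)

  module Chan (c : Ch) = Channel (T c)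

  labels : ∀ c → Chan.State c → List (Letter c)
  labels c x = map (Track.letter (T c)) (Chan.content x)

  TrackAction : Set
  TrackAction = Action Pos

  erase : TrackAction → A
  erase (c ! p) = c ! Track.letter (T c) p
  erase (c ⁇ p) = c ⁇ Track.letter (T c) p

  view : ∀ c → TrackAction → Local (Pos c)
  view c (d ! p) with d Fin.≟ c
  ... | yes refl = snd p
  ... | no _     = idle
  view c (d ⁇ p) with d Fin.≟ c
  ... | yes refl = rcv p
  ... | no _     = idle

  State : Set
  State = Q × (∀ c → Chan.State c)

  empty : State
  empty = q₀ , λ c → Chan.empty c

  config : State → Config M
  config (q , x) = q , λ c → labels c (x c)

  GStep : State → TrackAction → State → Set
  GStep (q , x) α (q′ , y) = (q , erase α , q′) ∈ₗ Δ × (∀ c → Chan.LStep c (x c) (view c α) (y c))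

  data QPath : Q → List TrackAction → Q → Set where
    []  : ∀ {q} → QPath q [] q
    _∷_ : ∀ {q α q′ π q″} → (q , erase α , q′) ∈ₗ Δ → QPath q′ π q″ → QPath q (α ∷ π) q″

  -- One control path and one path per channel over the same actions, so that results about single
  -- channels apply componentwise.
  GPath : State → List TrackAction → State → Set
  GPath (q , x) π (q′ , y) = QPath q π q′ × (∀ c → Chan.LPath c (x c) (map (view c) π) (y c))

  cons : ∀ {a α b π e} → GStep a α b → GPath b π e → GPath a (α ∷ π) e
  cons (t , s) (ts , ss) = t ∷ ts , λ c → s c Chan.∷ ss c

  uncons : ∀ {a α π e} → GPath a (α ∷ π) e → ∃[ b ] GStep a α b × GPath b π e
  uncons {q , x} {α} {π} {_ , z} (t ∷ ts , ss) =
    (_ , λ c → proj₁ (split (ss c))) , (t , λ c → proj₁ (proj₂ (split (ss c)))) , (ts , λ c → proj₂ (proj₂ (split (ss c))))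
    where
    split : ∀ {c x l ls z} → Chan.LPath c x (l ∷ ls) z → ∃[ y ] Chan.LStep c x l y × Chan.LPath c y ls z
    split (s Chan.∷ ss) = _ , s , ss

  view-! : ∀ c p → view c (c ! p) ≡ snd p
  view-! c p with c Fin.≟ c
  ... | yes refl = refl
  ... | no c≢c   = contradiction refl c≢c

  view-⁇ : ∀ c p → view c (c ⁇ p) ≡ rcv p
  view-⁇ c p with c Fin.≟ c
  ... | yes refl = refl
  ... | no c≢c   = contradiction refl c≢c

  view-!-other : ∀ {c d} p → d ≢ c → view d (c ! p) ≡ idle
  view-!-other {c} {d} p d≢c with c Fin.≟ d
  ... | yes c≡d = contradiction (sym c≡d) d≢c
  ... | no _    = refl

  view-⁇-other : ∀ {c d} p → d ≢ c → view d (c ⁇ p) ≡ idle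
  view-⁇-other {c} {d} p d≢c with c Fin.≟ d
  ... | yes c≡d = contradiction (sym c≡d) d≢c
  ... | no _    = refl

  labels-snd : ∀ {c x p y} → Chan.LStep c x (snd p) y → labels c y ≡ labels c x ++ Track.letter (T c) p ∷ []
  labels-snd (Chan.snd {ps = ps} _) = map-++ _ ps _

  labels-rcv : ∀ {c x p y} → Chan.LStep c x (rcv p) y → labels c x ≡ Track.letter (T c) p ∷ labels c y
  labels-rcv Chan.rcv = refl

  labels-idle : ∀ {c x y} → Chan.LStep c x idle y → labels c y ≡ labels c x
  labels-idle Chan.idle = refl

  config-step : ∀ {a α b} → GStep a α b → Step M (config a) (erase α) (config b)
  config-step {q , x} {c ! p} {q′ , y} (t , s) = send t
    (labels-snd (subst (λ l → Chan.LStep c _ l _) (view-! c p) (s c)))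
    (λ d d≢c → labels-idle (subst (λ l → Chan.LStep d _ l _) (view-!-other p d≢c) (s d)))
  config-step {q , x} {c ⁇ p} {q′ , y} (t , s) = receive t
    (labels-rcv (subst (λ l → Chan.LStep c _ l _) (view-⁇ c p) (s c)))
    (λ d d≢c → labels-idle (subst (λ l → Chan.LStep d _ l _) (view-⁇-other p d≢c) (s d)))

  proj!-erase : ∀ c π → map (Track.letter (T c)) (sends (map (view c) π)) ≡ proj! M c (map erase π)
  proj!-erase c []            = refl
  proj!-erase c ((d ! p) ∷ π) with d Fin.≟ c
  ... | yes refl = cong (_ ∷_) (proj!-erase c π)
  ... | no _     = proj!-erase c π
  proj!-erase c ((d ⁇ p) ∷ π) with d Fin.≟ c
  ... | yes refl = proj!-erase c π
  ... | no _     = proj!-erase c π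

  path-prefix : ∀ {π e} → GPath empty π e → map erase π ∈ Pref (L! M L)
  path-prefix {π} (_ , ss) = proj!-pref M L (map erase π) λ c →
    subst (Pref (L c)) (proj!-erase c π) (Track.sound (T c) (Chan.path-sends c (ss c)))

  Repeatable : State → Set
  Repeatable (q , x) = ∃[ α ] ∃[ π ] QPath q (α ∷ π) q × (∀ c → Chan.Loop c (x c) (map (view c) (α ∷ π)))

  Live : State → Set
  Live a = ∃[ π ] ∃[ b ] GPath a π b × Repeatable b

  unroll : ∀ {a} → Live a → ∃[ α ] ∃[ b ] GStep a α b × Live b
  unroll (α ∷ π , e , path , rep) with uncons path
  ... | b , s , path′ = α , b , s , π , e , path′ , rep
  -- The lead-in is used up: the loop becomes the new lead-in, and `repeat` supplies a loop at its
  -- end. The states `x` and `x′` agree only pointwise, hence the `subst`.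
  unroll {q , x} ([] , (_ , x′) , ([] , ss) , α , π , ts , loops) =
    case uncons (ts , λ c → subst (λ z → Chan.LPath c z _ _) (sym (nil (ss c))) (Chan.Loop.path (loops c))) of λ where
      (b , s , path) → α , b , s , π , _ , path , α , π , ts , λ c → Chan.repeat c (loops c)
    where
    nil : ∀ {c y z} → Chan.LPath c y [] z → y ≡ z
    nil Chan.[] = refl

  steps-path : (st : ℕ → State) (α : ℕ → TrackAction) → (∀ i → GStep (st i) (α i) (st (suc i))) →
    ∀ i → GPath (st 0) (applyUpTo α i) (st i)
  steps-path st α steps zero    = [] , λ c → Chan.[]
  steps-path st α steps (suc i) = cons (steps 0) (steps-path (st ∘ suc) (α ∘ suc) (steps ∘ suc) i)

  live-execution : Live empty → InfiniteExecution M L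
  live-execution live = record
    { s        = config ∘ st
    ; β        = erase ∘ α
    ; starts   = refl
    ; steps    = config-step ∘ steps
    ; prefixes = λ i → subst (_∈ Pref (L! M L)) (map-applyUpTo α erase i) (path-prefix (steps-path st α steps i))
    }
    where
    run : ℕ → ∃ Live
    run zero    = empty , live
    run (suc i) with unroll (proj₂ (run i))
    ... | _ , b , _ , live′ = b , live′

    st : ℕ → State
    st i = proj₁ (run i)

    α : ℕ → TrackAction
    α i = proj₁ (unroll (proj₂ (run i)))

    steps : ∀ i → GStep (st i) (α i) (st (suc i))
    steps i = proj₁ (proj₂ (proj₂ (unroll (proj₂ (run i)))))

  -- Search of the tree of runs

  infix 4 _⊑_

  _⊑_ : Rel State 0ℓ
  (q , x) ⊑ (q′ , y) = q ≡ q′ × (∀ c → Chan._⊑_ c (x c) (y c))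

  af-⊑ : AlmostFull _⊑_
  af-⊑ = af-× (af-on proj₁ af-≡Fin) (af-Π λ c → af-on (λ a → proj₂ a c) (Chan.af-⊑ c))

  repeatable : ∀ {a α π b} → (∀ c → Chan.Valid c (proj₂ a c)) → GPath a (α ∷ π) b → a ⊑ b → Repeatable a
  repeatable {α = α} {π} v (ts , ss) (refl , x⊑y) = α , π , ts , λ c → Chan.loop c (ss c) (v c) (x⊑y c)

  -- An inductive bar on the tree of runs. The execution in `stop` starts from the initial
  -- configuration, not from a.
  data Barred (a : State) : Set where
    stop : InfiniteExecution M L → Barred a
    step : (∀ {α b} → GStep a α b → Barred b) → Barred a

  -- Each step feeds the current state to the almost-full proof. The new disjunct concerns pairs
  -- beginning at that state, and these are joined by a non-empty path as well.
  barred : ∀ {R a} → AlmostFull R →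
    (∀ {π b α ρ e} → GPath a π b → GPath b (α ∷ ρ) e → R b e → InfiniteExecution M L) → Barred a
  barred {a = a} (now r) inf = step λ s →
    stop (inf {b = a} ([] , λ c → Chan.[]) (cons s ([] , λ c → Chan.[])) (r _ _))
  barred {a = a} (later f) inf = step λ s → barred (f a) λ where
    p p′ (inj₁ r) → inf (cons s p) p′ r
    p p′ (inj₂ r) → inf {b = a} ([] , λ c → Chan.[]) (cons s p) r

  barred-empty : Barred empty
  barred-empty = barred af-⊑ λ {π} {b} p p′ b⊑e →
    live-execution (π , b , p , repeatable (λ c → Chan.valid-path c (proj₂ p c) []) p′ b⊑e)

  NoRun : ℕ → State → Set
  NoRun N a = ∀ {π e} → N ≤ length π → ¬ GPath a π e

  noRun-mono : ∀ {a m n} → m ≤ n → NoRun m a → NoRun n a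
  noRun-mono m≤n none n≤ = none (ℕ.≤-trans m≤n n≤)

  noRun-suc : ∀ {N a} → (∀ {α b} → GStep a α b → NoRun N b) → NoRun (suc N) a
  noRun-suc none {_ ∷ _} (s≤s N≤) path with uncons path
  ... | _ , s , path′ = none s N≤ path′

  NoRunVia : State → TrackAction → Q → ℕ → Set
  NoRunVia a α q N = ∀ {y} → GStep a α (q , y) → NoRun N (q , y)

  module _ {I : Set} {a : State} (f : ∀ {α b} → GStep a α b → I ⊎ ∃[ N ] NoRun N b) where

    -- The successor is determined by α and q only up to pointwise equality.
    noRunVia : ∀ α q → I ⊎ ∃ (NoRunVia a α q)
    noRunVia α q with transition? M (proj₁ a , erase α , q) ×-dec Fin.all? (λ c → Chan.lstep? c (proj₂ a c) (view c α))
    ... | no ¬s       = inj₂ (0 , λ { (t , s) → contradiction (t , λ c → _ , s c) ¬s })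
    ... | yes (t , s) = Sum.map₂
      (λ { (N , none) → N , λ { (_ , s′) N≤ (ts , ss) → none N≤
           (ts , λ c → subst (λ z → Chan.LPath c z _ _) (Chan.lstep-functional c (s′ c) (proj₂ (s c))) (ss c)) } })
      (f (t , λ c → proj₂ (s c)))

    finiteMoves : Finite (Q × Σ Ch Pos)
    finiteMoves = finiteΣ (finiteFin _) λ _ → finiteΣ (finiteFin _) λ c → Track.finite (T c)

    noRun : I ⊎ ∃[ N ] NoRun N a
    noRun with uniformBound {P = λ { (q , c , p) → NoRunVia a (c ! p) q }} finiteMoves
                 (λ m≤n none s → noRun-mono m≤n (none s)) (λ { (q , c , p) → noRunVia (c ! p) q })
             | uniformBound {P = λ { (q , c , p) → NoRunVia a (c ⁇ p) q }} finiteMoves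
                 (λ m≤n none s → noRun-mono m≤n (none s)) (λ { (q , c , p) → noRunVia (c ⁇ p) q })
    ... | inj₁ i          | _               = inj₁ i
    ... | inj₂ _          | inj₁ i          = inj₁ i
    ... | inj₂ (m , viaSend) | inj₂ (n , viaReceive) = inj₂ (suc (m ⊔ n) , noRun-suc λ
      { {c ! p} s → noRun-mono (ℕ.m≤m⊔n m n) (viaSend (_ , c , p) s)
      ; {c ⁇ p} s → noRun-mono (ℕ.m≤n⊔m m n) (viaReceive (_ , c , p) s) })

  -- A constructive form of König's lemma: recursion on the bar, where finite branching provides a
  -- common bound at every node.
  search : ∀ {a} → Barred a → InfiniteExecution M L ⊎ ∃[ N ] NoRun N a
  search (stop e) = inj₁ e
  search (step f) = noRun λ s → search (f s)

  -- Annotating an execution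

  Future : ∀ c → Chan.State c → List A → Set
  Future c x σ = ∃[ ps ] ∃[ e ] Walk (Track.Next (T c)) (Chan.sent x) ps e × map (Track.letter (T c)) ps ≡ proj! M c σ

  -- A send takes the next position of a walk fixed in advance for all sends to come, which resolves
  -- the choices of the track; a receive takes the position at the head of the content.
  annotate-step : ∀ {q w b q′ w′} → Step M (q , w) b (q′ , w′) →
    ∀ x → (∀ c → labels c (x c) ≡ w c) → ∀ σ → (∀ c → Future c (x c) (b ∷ σ)) →
    ∃[ α ] ∃[ y ] GStep (q , x) α (q′ , y) × (∀ c → labels c (y c) ≡ w′ c) × (∀ c → Future c (y c) σ)
  annotate-step {w′ = w′} (send {q = q} {q′} {c} {a} t w′c w′d) x x≡w σ future
    with future c
  ... | fc rewrite sentOn-self M c a with fc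
  ... | p ∷ ps , e , n ∷ wk , eq with refl , eq′ ← ∷-injective eq =
    c ! p , (λ d → proj₁ (move d)) , (t , λ d → proj₁ (proj₂ (move d))) ,
    (λ d → proj₁ (proj₂ (proj₂ (move d)))) , (λ d → proj₂ (proj₂ (proj₂ (move d))))
    where
    move : ∀ d → ∃[ y ] Chan.LStep d (x d) (view d (c ! p)) y × labels d y ≡ w′ d × Future d y σ
    move d with c Fin.≟ d | future d
    ... | yes refl | _ = _ , Chan.snd n ,
      trans (map-++ (Track.letter (T c)) (Chan.content (x c)) _) (trans (cong (_++ a ∷ []) (x≡w c)) (sym w′c)) , ps , e , wk , eq′
    ... | no c≢d | fd = x d , Chan.idle , trans (x≡w d) (sym (w′d d (c≢d ∘ sym))) , fd
  annotate-step {w′ = w′} (receive {q = q} {q′} {c} {a} {w} t wc w′d) x x≡w σ future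
    with Chan.content (x c) in xc | trans (x≡w c) wc
  ... | p ∷ ps | eq with refl , eq′ ← ∷-injective eq =
    c ⁇ p , (λ d → proj₁ (move d)) , (t , λ d → proj₁ (proj₂ (move d))) ,
    (λ d → proj₁ (proj₂ (proj₂ (move d)))) , (λ d → proj₂ (proj₂ (proj₂ (move d))))
    where
    receiving : ∀ {z} → Chan.content z ≡ p ∷ ps → Chan.LStep c z (rcv p) Channel.⟨ just p , ps , Chan.sent z ⟩
    receiving {Channel.⟨ _ , _ , _ ⟩} refl = Chan.rcv

    move : ∀ d → ∃[ y ] Chan.LStep d (x d) (view d (c ⁇ p)) y × labels d y ≡ w′ d × Future d y σ
    move d with c Fin.≟ d
    ... | yes refl = _ , receiving xc , eq′ , future c
    ... | no c≢d   = x d , Chan.idle , trans (x≡w d) (sym (w′d d (c≢d ∘ sym))) , future d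

  -- Every finite prefix gets its own annotation. Those of different lengths need not agree, as only
  -- the lengths of runs are compared with the bound.
  annotate : ∀ N (s : ℕ → Config M) (β : ℕ → A) → (∀ i → Step M (s i) (β i) (s (suc i))) →
    ∀ x → (∀ c → labels c (x c) ≡ proj₂ (s 0) c) → (∀ c → Future c (x c) (applyUpTo β N)) →
    ∃[ π ] ∃[ e ] N ≤ length π × GPath (proj₁ (s 0) , x) π e
  annotate zero    s β steps x x≡ future = [] , _ , z≤n , [] , λ c → Chan.[]
  annotate (suc N) s β steps x x≡ future with annotate-step (steps 0) x x≡ (applyUpTo (β ∘ suc) N) future
  ... | α , y , st , y≡ , future′ with annotate N (s ∘ suc) (β ∘ suc) (steps ∘ suc) y y≡ future′
  ... | π , e , N≤ , path = α ∷ π , e , s≤s N≤ , cons st path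

  noRun⇒terminates : ∀ {N} → NoRun N empty → IBTerminates M L
  noRun⇒terminates {N} none exec =
    let open InfiniteExecution exec
        π , e , N≤ , path = annotate N s β steps (λ c → Chan.empty c)
          (λ c → cong (λ a → proj₂ a c) (sym starts))
          (λ c → Track.complete (T c) (pref-proj! M L (applyUpTo β N) (prefixes N) c))
    in none N≤ (subst (λ q → GPath (q , λ c → Chan.empty c) π e) (cong proj₁ starts) path)

  ibTerminates? : Dec (IBTerminates M L)
  ibTerminates? = [ (λ exec → no λ terminates → terminates exec) , (λ { (_ , none) → yes (noRun⇒terminates none) }) ]′
    (search barred-empty)

theorem5p11 : (M : FIFOMachine) →
    (L : (c : FIFOMachine.Ch M) → Language (FIFOMachine.Letter M c)) →
    (∀ c → Satisfiable (L c)) →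
    (∀ c → Regular (L c)) →
    (∀ c → Bounded (L c)) →
    Dec (IBTerminates M L)
theorem5p11 M L nonempty regular bounded =
  Runs.ibTerminates? M L λ c → boundedTrack (nonempty c) (regular c) (bounded c)
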